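{- A maximum $3\times 3$ board contains six prisoners, i.e. $P(3)=6$.
   Context: A configuration on an $n\times n$ board assigns to each of the $n^2$ squares exactly one occupant, either a prisoner or a guard. Two distinct squares are adjacent if one is directly above, below, to the left, to the right, or diagonal to the other (king-move adjacency). A configuration is valid (a valid board) if every square occupied by a prisoner is adjacent to at least as many squares occupied by guards as squares occupied by (other) prisoners. A maximum configuration (maximum board) is a valid board that has the greatest number of prisoners among all valid boards on the $n\times n$ board. $P(n)$ denotes the number of prisoners in a maximum configuration on the $n\times n$ board. -}

module Defs where

open import Data.Fin.Base using (Fin; toℕ)
import Data.Fin.Properties as Fin
open import Data.List.Base
  using (List; []; _∷_; [_]; length; filter; allFin; cartesianProduct; cartesianProductWith)
import Data.List.Extrema
open import Data.List.Membership.Propositional using (_∈_)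
open import Data.List.Membership.Propositional.Properties
  using (∈-cartesianProductWith⁺; ∈-filter⁺)
open import Data.List.Relation.Unary.All as All using (All)
open import Data.List.Relation.Unary.All.Properties using (all-filter)
open import Data.List.Relation.Unary.Any using (here; there)
open import Data.Nat.Base using (ℕ; zero; suc; _≤_; ∣_-_∣)
open import Data.Nat.Properties using (_≤?_; ≤-totalOrder)
open import Data.Product.Base using (_×_; _,_; ∃; proj₁; proj₂)
open import Data.Product.Properties using (≡-dec)
open import Data.Vec.Base as Vec using (Vec; []; _∷_)
open import Data.Vec.Properties using (lookup-replicate)
open import Relation.Binary.Definitions using (DecidableEquality)
open import Relation.Binary.PropositionalEquality
  using (_≡_; _≢_; refl; sym; trans; cong)
open import Relation.Nullary.Decidable using (Dec; yes; no; ¬?; _×-dec_; _→-dec_; map′)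

open Data.List.Extrema ≤-totalOrder using (argmax; argmax-all; f[xs]≤f[argmax])

data Occupant : Set where
  prisoner guard : Occupant

_≟ᵒ_ : DecidableEquality Occupant
prisoner ≟ᵒ prisoner = yes refl
prisoner ≟ᵒ guard    = no λ ()
guard    ≟ᵒ prisoner = no λ ()
guard    ≟ᵒ guard    = yes refl

Square : ℕ → Set
Square n = Fin n × Fin n

squares : ∀ n → List (Square n)
squares n = cartesianProduct (allFin n) (allFin n)

Adjacent : ∀ {n} → Square n → Square n → Set
Adjacent (i , j) (k , l) =
  (i , j) ≢ (k , l) × ∣ toℕ i - toℕ k ∣ ≤ 1 × ∣ toℕ j - toℕ l ∣ ≤ 1

adjacent? : ∀ {n} (s t : Square n) → Dec (Adjacent s t)
adjacent? (i , j) (k , l) =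
  ¬? (≡-dec Fin._≟_ Fin._≟_ (i , j) (k , l))
    ×-dec (∣ toℕ i - toℕ k ∣ ≤? 1 ×-dec ∣ toℕ j - toℕ l ∣ ≤? 1)

Configuration : ℕ → Set
Configuration n = Vec (Vec Occupant n) n

occupant : ∀ {n} → Configuration n → Square n → Occupant
occupant c (i , j) = Vec.lookup (Vec.lookup c i) j

neighbours : ∀ {n} → Configuration n → Occupant → Square n → ℕ
neighbours {n} c o s =
  length (filter (λ t → adjacent? s t ×-dec (occupant c t ≟ᵒ o)) (squares n))

prisoners : ∀ {n} → Configuration n → ℕ
prisoners {n} c = length (filter (λ s → occupant c s ≟ᵒ prisoner) (squares n))

Valid : ∀ {n} → Configuration n → Set
Valid {n} c = ∀ (s : Square n) → occupant c s ≡ prisoner →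
              neighbours c prisoner s ≤ neighbours c guard s

Maximum : ∀ {n} → Configuration n → Set
Maximum {n} c = Valid c × (∀ (d : Configuration n) → Valid d → prisoners d ≤ prisoners c)

valid? : ∀ {n} (c : Configuration n) → Dec (Valid c)
valid? c = map′ (λ f (i , j) → f i j) (λ f i j → f (i , j))
  (Fin.all? λ i → Fin.all? λ j →
    (occupant c (i , j) ≟ᵒ prisoner)
      →-dec (neighbours c prisoner (i , j) ≤? neighbours c guard (i , j)))

vectors : ∀ {A : Set} → List A → ∀ n → List (Vec A n)
vectors xs zero    = [ [] ]
vectors xs (suc n) = cartesianProductWith _∷_ xs (vectors xs n)

vectors-complete : ∀ {A : Set} {xs : List A} → (∀ x → x ∈ xs) →
                   ∀ {n} (v : Vec A n) → v ∈ vectors xs n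
vectors-complete complete []      = here refl
vectors-complete complete (x ∷ v) =
  ∈-cartesianProductWith⁺ _∷_ (complete x) (vectors-complete complete v)

occupants : List Occupant
occupants = prisoner ∷ guard ∷ []

occupants-complete : ∀ o → o ∈ occupants
occupants-complete prisoner = here refl
occupants-complete guard    = there (here refl)

configurations : ∀ n → List (Configuration n)
configurations n = vectors (vectors occupants n) n

configurations-complete : ∀ {n} (c : Configuration n) → c ∈ configurations n
configurations-complete = vectors-complete (vectors-complete occupants-complete)

allGuards : ∀ n → Configuration n
allGuards n = Vec.replicate n (Vec.replicate n guard)

allGuards-valid : ∀ n → Valid (allGuards n)
allGuards-valid n (i , j) eq with () ← trans (sym eq) (trans
  (cong (λ row → Vec.lookup row j) (lookup-replicate i (Vec.replicate n guard)))
  (lookup-replicate j guard))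

maximum-exists : ∀ n → ∃ λ (c : Configuration n) → Maximum c
maximum-exists n =
    argmax prisoners (allGuards n) valids
  , argmax-all prisoners (allGuards-valid n) (all-filter valid? (configurations n))
  , λ d d-valid → All.lookup (f[xs]≤f[argmax] (allGuards n) valids)
      (∈-filter⁺ valid? (configurations-complete d) d-valid)
  where
  valids : List (Configuration n)
  valids = filter valid? (configurations n)

-- Independent of which maximum configuration is chosen: any two bound each
-- other's number of prisoners.
P : ℕ → ℕ
P n = prisoners (proj₁ (maximum-exists n))

{-# OPTIONS --safe #-}
module Submission where

open import Defs
open import Data.List.Relation.Unary.All as All using (All)
open import Data.Nat.Base using (_≤_)
open import Data.Nat.Properties using (_≤?_; ≤-antisym)
open import Data.Product.Base using (_×_; _,_)
open import Data.Sum.Base using (_⊎_; fromInj₁)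
open import Data.Vec.Base using ([]; _∷_)
open import Relation.Binary.PropositionalEquality using (_≡_)
open import Relation.Nullary using (¬_; contradiction)
open import Relation.Nullary.Decidable using (from-yes; ¬?; _⊎-dec_)

guardedRow : Configuration 3
guardedRow = (prisoner ∷ prisoner ∷ prisoner ∷ [])
           ∷ (guard    ∷ guard    ∷ guard    ∷ [])
           ∷ (prisoner ∷ prisoner ∷ prisoner ∷ [])
           ∷ []

-- A corner prisoner has one prisoner and two guards next to it; a prisoner in the middle of a side
-- has two prisoners and three guards.
guardedRow-valid : Valid guardedRow
guardedRow-valid = from-yes (valid? guardedRow)

-- A board with at most two guards has a prisoner on one of the four middle
-- squares of the sides; that prisoner has five neighbours and would need three
-- guards. The disjuncts are ordered so that validity is only evaluated on the
-- boards with more than six prisoners.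
≤6-or-invalid : All (λ c → prisoners c ≤ 6 ⊎ ¬ Valid c) (configurations 3)
≤6-or-invalid =
  from-yes (All.all? (λ c → (prisoners c ≤? 6) ⊎-dec ¬? (valid? c)) (configurations 3))

valid⇒prisoners≤6 : ∀ (c : Configuration 3) → Valid c → prisoners c ≤ 6
valid⇒prisoners≤6 c c-valid =
  fromInj₁ (contradiction c-valid) (All.lookup ≤6-or-invalid (configurations-complete c))

maximum⇒prisoners≡6 : ∀ (c : Configuration 3) → Maximum c → prisoners c ≡ 6
maximum⇒prisoners≡6 c (c-valid , c-max) =
  -- `prisoners guardedRow` evaluates to 6, so maximality against this board is the lower bound.
  ≤-antisym (valid⇒prisoners≤6 c c-valid) (c-max guardedRow guardedRow-valid)

theorem2p2 : (∀ (c : Configuration 3) → Maximum c → prisoners c ≡ 6) × P 3 ≡ 6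
theorem2p2 =
    maximum⇒prisoners≡6
  -- `P 3` unfolds to the count on the board that `maximum-exists 3` picks, an instance of the
  -- general bound.
  , (let (c , c-max) = maximum-exists 3 in maximum⇒prisoners≡6 c c-max)
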